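{- There is an absolute constant $c>0$ such that the following holds. Let $A=\{a_1<\dots<a_k\}$ and $A'=\{a'_1<\dots<a'_k\}$ be sets of real numbers, each with $k$ elements, having distinct pairs of consecutive differences, and let $B,B'$ be arbitrary finite nonempty sets of real numbers. Then \[ |A+B|\cdot|A'+B'|\ge c\left(k^3|B||B'|\right)^{1/2}. \] In particular, if $k=|A|=|A'|=|B|=|B'|$, then $|A+B|\cdot|A'+B'|\ge c\,k^{5/2}$.
   Context: For finite $X,Y\subset\mathbb{R}$, $X+Y=\{x+y:x\in X,y\in Y\}$. For $1\le i\le k-1$ let $d_i=a_{i+1}-a_i$ and $d'_i=a'_{i+1}-a'_i$. The sets $A$ and $A'$ have distinct pairs of consecutive differences if the ordered pairs $(d_i,d'_i)$, $1\le i\le k-1$, are pairwise distinct. -}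

module Defs where

open import Level using (0ℓ)
open import Data.Nat as ℕ using (ℕ; zero; suc)
import Data.Nat.Properties as ℕ
open import Data.Nat.Solver using (module +-*-Solver)
open import Data.Integer as ℤ using (+_; +<+)
import Data.Integer.Properties as ℤ
open import Data.Rational as ℚ using (ℚ; mkℚ; 0ℚ; 1ℚ; ½; *<*)
import Data.Rational.Properties as ℚ
import Data.Rational.Unnormalised as ℚᵘ
import Data.Rational.Unnormalised.Properties as ℚᵘ
import Data.Rational.Solver as ℚ-Solver
open import Data.Fin as Fin using (Fin; zero; suc; inject₁)
import Data.Fin.Properties as Fin
open import Data.Product using (Σ; _×_; _,_; ∃; ∃₂; proj₁; proj₂)
open import Data.Sum using (inj₁; inj₂)
open import Function using (_∘_)
open import Function.Definitions using (Injective)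
open import Relation.Binary using (IsEquivalence; Setoid)
open import Relation.Binary.PropositionalEquality
  using (_≡_; _≢_; refl; sym; trans; cong; cong₂; subst; subst₂)
open import Relation.Nullary using (¬_; yes; no; contradiction)
open import Relation.Nullary.Decidable using (¬¬-excluded-middle)
open import Relation.Unary using (Pred; _≐_)

IsCauchy : (ℕ → ℚ) → Set
IsCauchy u = ∀ ε → 0ℚ ℚ.< ε →
  ∃ λ N → ∀ m n → N ℕ.≤ m → N ℕ.≤ n → ℚ.∣ u m ℚ.- u n ∣ ℚ.< ε

record ℝ : Set where
  constructor mkℝ
  field
    seq    : ℕ → ℚ
    cauchy : IsCauchy seq

open ℝ public

infix 4 _≈_ _<_ _≤_

-- Records rather than plain definitions, so that x and y can be inferred.
record _≈_ (x y : ℝ) : Set where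
  constructor mk≈
  field
    close : ∀ ε → 0ℚ ℚ.< ε →
      ∃ λ N → ∀ n → N ℕ.≤ n → ℚ.∣ seq x n ℚ.- seq y n ∣ ℚ.< ε

record _<_ (x y : ℝ) : Set where
  constructor mk<
  field
    separated : ∃ λ ε → 0ℚ ℚ.< ε ×
      ∃ λ N → ∀ n → N ℕ.≤ n → seq x n ℚ.+ ε ℚ.≤ seq y n

open _≈_ public
open _<_ public

_≤_ : ℝ → ℝ → Set
x ≤ y = ¬ (y < x)

private
  module R = ℚ-Solver.+-*-Solver

½-split : ∀ ε → ½ ℚ.* ε ℚ.+ ½ ℚ.* ε ≡ ε
½-split ε = trans (sym (ℚ.*-distribʳ-+ ε ½ ½)) (ℚ.*-identityˡ ε)

*-pos : ∀ {p q} → 0ℚ ℚ.< p → 0ℚ ℚ.< q → 0ℚ ℚ.< p ℚ.* q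
*-pos {p} {q} 0<p 0<q =
  subst (ℚ._< p ℚ.* q) (ℚ.*-zeroʳ p)
    (ℚ.*-monoʳ-<-pos p ⦃ ℚ.positive 0<p ⦄ 0<q)

½-pos : ∀ {ε} → 0ℚ ℚ.< ε → 0ℚ ℚ.< ½ ℚ.* ε
½-pos = *-pos (ℚ.positive⁻¹ ½)

d-refl : ∀ {ε} p → 0ℚ ℚ.< ε → ℚ.∣ p ℚ.- p ∣ ℚ.< ε
d-refl {ε} p = subst (λ t → ℚ.∣ t ∣ ℚ.< ε) (sym (ℚ.+-inverseʳ p))

d-sym : ∀ p q → ℚ.∣ p ℚ.- q ∣ ≡ ℚ.∣ q ℚ.- p ∣
d-sym p q = trans (sym (ℚ.∣-p∣≡∣p∣ (p ℚ.- q)))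
  (cong ℚ.∣_∣ (R.solve 2 (λ p q → R.:- (p R.:- q) R.:= q R.:- p) refl p q))

d-trans : ∀ p q r → ℚ.∣ p ℚ.- r ∣ ℚ.≤ ℚ.∣ p ℚ.- q ∣ ℚ.+ ℚ.∣ q ℚ.- r ∣
d-trans p q r = subst (ℚ._≤ ℚ.∣ p ℚ.- q ∣ ℚ.+ ℚ.∣ q ℚ.- r ∣)
  (cong ℚ.∣_∣ (R.solve 3 (λ p q r →
    (p R.:- q) R.:+ (q R.:- r) R.:= p R.:- r) refl p q r))
  (ℚ.∣p+q∣≤∣p∣+∣q∣ (p ℚ.- q) (q ℚ.- r))

d-+ : ∀ p q r s → ℚ.∣ (p ℚ.+ q) ℚ.- (r ℚ.+ s) ∣
                    ℚ.≤ ℚ.∣ p ℚ.- r ∣ ℚ.+ ℚ.∣ q ℚ.- s ∣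
d-+ p q r s = subst (ℚ._≤ ℚ.∣ p ℚ.- r ∣ ℚ.+ ℚ.∣ q ℚ.- s ∣)
  (cong ℚ.∣_∣ (R.solve 4 (λ p q r s →
    (p R.:- r) R.:+ (q R.:- s) R.:= (p R.:+ q) R.:- (r R.:+ s)) refl p q r s))
  (ℚ.∣p+q∣≤∣p∣+∣q∣ (p ℚ.- r) (q ℚ.- s))

d-neg : ∀ p q → ℚ.∣ (ℚ.- p) ℚ.- (ℚ.- q) ∣ ≡ ℚ.∣ p ℚ.- q ∣
d-neg p q = trans
  (cong ℚ.∣_∣ (R.solve 2 (λ p q →
    (R.:- p) R.:- (R.:- q) R.:= q R.:- p) refl p q))
  (d-sym q p)

d-* : ∀ p q r s → ℚ.∣ p ℚ.* q ℚ.- r ℚ.* s ∣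
        ℚ.≤ ℚ.∣ p ∣ ℚ.* ℚ.∣ q ℚ.- s ∣ ℚ.+ ℚ.∣ s ∣ ℚ.* ℚ.∣ p ℚ.- r ∣
d-* p q r s = subst₂ ℚ._≤_
  (cong ℚ.∣_∣ (R.solve 4 (λ p q r s →
    p R.:* (q R.:- s) R.:+ s R.:* (p R.:- r) R.:= p R.:* q R.:- r R.:* s)
    refl p q r s))
  (cong₂ ℚ._+_ (ℚ.∣p*q∣≡∣p∣*∣q∣ p (q ℚ.- s)) (ℚ.∣p*q∣≡∣p∣*∣q∣ s (p ℚ.- r)))
  (ℚ.∣p+q∣≤∣p∣+∣q∣ (p ℚ.* (q ℚ.- s)) (s ℚ.* (p ℚ.- r)))

half<half : ∀ {p a b ε} → p ℚ.≤ a ℚ.+ b →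
            a ℚ.< ½ ℚ.* ε → b ℚ.< ½ ℚ.* ε → p ℚ.< ε
half<half {ε = ε} p≤ a< b< =
  ℚ.≤-<-trans p≤ (subst (_ ℚ.<_) (½-split ε) (ℚ.+-mono-< a< b<))

bounded : ∀ u → IsCauchy u →
          ∃₂ λ K N → 0ℚ ℚ.< K × (∀ n → N ℕ.≤ n → ℚ.∣ u n ∣ ℚ.≤ K)
bounded u c with c 1ℚ (ℚ.positive⁻¹ 1ℚ)
... | N , h = 1ℚ ℚ.+ ℚ.∣ u N ∣ , N ,
  ℚ.<-≤-trans (ℚ.positive⁻¹ 1ℚ)
    (subst (ℚ._≤ 1ℚ ℚ.+ ℚ.∣ u N ∣) (ℚ.+-identityʳ 1ℚ)
      (ℚ.+-monoʳ-≤ 1ℚ (ℚ.0≤∣p∣ (u N)))) ,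
  λ n N≤n → ℚ.≤-trans
    (subst (ℚ._≤ ℚ.∣ u n ℚ.- u N ∣ ℚ.+ ℚ.∣ u N ∣)
      (cong ℚ.∣_∣ (R.solve 2 (λ p q → (p R.:- q) R.:+ q R.:= p) refl (u n) (u N)))
      (ℚ.∣p+q∣≤∣p∣+∣q∣ (u n ℚ.- u N) (u N)))
    (ℚ.+-monoˡ-≤ ℚ.∣ u N ∣ (ℚ.<⇒≤ (h n N N≤n ℕ.≤-refl)))

quotient : ∀ {ε K} → 0ℚ ℚ.< ε → 0ℚ ℚ.< K → ∃ λ δ → 0ℚ ℚ.< δ × K ℚ.* δ ≡ ε
quotient {ε} {K} 0<ε 0<K = ℚ.1/ K ℚ.* ε ,
  *-pos (ℚ.positive⁻¹ (ℚ.1/ K) ⦃ ℚ.1/pos⇒pos K ⦄) 0<ε ,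
  trans (sym (ℚ.*-assoc K (ℚ.1/ K) ε))
    (trans (cong (ℚ._* ε) (ℚ.*-inverseʳ K)) (ℚ.*-identityˡ ε))
  where
  instance
    K-pos : ℚ.Positive K
    K-pos = ℚ.positive 0<K
    K≢0 : ℚ.NonZero K
    K≢0 = ℚ.pos⇒nonZero K

scaled< : ∀ {K δ ε a b} → 0ℚ ℚ.< K → K ℚ.* δ ≡ ε →
          a ℚ.≤ K → 0ℚ ℚ.≤ b → b ℚ.< δ → a ℚ.* b ℚ.< ε
scaled< {K} {b = b} 0<K Kδ≡ε a≤K 0≤b b<δ = ℚ.≤-<-trans
  (ℚ.*-monoʳ-≤-nonNeg b ⦃ ℚ.nonNegative 0≤b ⦄ a≤K)
  (subst (K ℚ.* b ℚ.<_) Kδ≡ε (ℚ.*-monoʳ-<-pos K ⦃ ℚ.positive 0<K ⦄ b<δ))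

≈-isEquivalence : IsEquivalence _≈_
≈-isEquivalence = record
  { refl  = λ {x} → mk≈ λ ε 0<ε → 0 , λ n _ → d-refl (seq x n) 0<ε
  ; sym   = λ {x} {y} x≈y → mk≈ λ ε 0<ε → let N , h = close x≈y ε 0<ε in
      N , λ n N≤n → subst (ℚ._< ε) (d-sym (seq x n) (seq y n)) (h n N≤n)
  ; trans = λ {x} {y} {z} x≈y y≈z → mk≈ λ ε 0<ε →
      let M , g = close x≈y (½ ℚ.* ε) (½-pos 0<ε)
          N , h = close y≈z (½ ℚ.* ε) (½-pos 0<ε)
      in M ℕ.⊔ N , λ n le →
           half<half (d-trans (seq x n) (seq y n) (seq z n))
             (g n (ℕ.m⊔n≤o⇒m≤o M N le)) (h n (ℕ.m⊔n≤o⇒n≤o M N le))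
  }

ℝ-setoid : Setoid 0ℓ 0ℓ
ℝ-setoid = record { isEquivalence = ≈-isEquivalence }

abstract
  const-cauchy : ∀ q → IsCauchy (λ _ → q)
  const-cauchy q ε 0<ε = 0 , λ _ _ _ _ → d-refl q 0<ε

  +-cauchy : ∀ u v → IsCauchy u → IsCauchy v → IsCauchy (λ n → u n ℚ.+ v n)
  +-cauchy u v cu cv ε 0<ε =
    let M , g = cu (½ ℚ.* ε) (½-pos 0<ε)
        N , h = cv (½ ℚ.* ε) (½-pos 0<ε)
    in M ℕ.⊔ N , λ m n le le′ →
         half<half (d-+ (u m) (v m) (u n) (v n))
           (g m n (ℕ.m⊔n≤o⇒m≤o M N le) (ℕ.m⊔n≤o⇒m≤o M N le′))
           (h m n (ℕ.m⊔n≤o⇒n≤o M N le) (ℕ.m⊔n≤o⇒n≤o M N le′))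

  neg-cauchy : ∀ u → IsCauchy u → IsCauchy (λ n → ℚ.- u n)
  neg-cauchy u cu ε 0<ε = let N , h = cu ε 0<ε in
    N , λ m n le le′ → subst (ℚ._< ε) (sym (d-neg (u m) (u n))) (h m n le le′)

  *-cauchy : ∀ u v → IsCauchy u → IsCauchy v → IsCauchy (λ n → u n ℚ.* v n)
  *-cauchy u v cu cv ε 0<ε =
    let K , M₁ , 0<K , u≤K = bounded u cu
        L , M₂ , 0<L , v≤L = bounded v cv
        δ , 0<δ , Kδ = quotient (½-pos 0<ε) 0<K
        η , 0<η , Lη = quotient (½-pos 0<ε) 0<L
        N₁ , g = cv δ 0<δ
        N₂ , h = cu η 0<η
        M = M₁ ℕ.⊔ M₂
        N = N₁ ℕ.⊔ N₂
    in M ℕ.⊔ N , λ m n le le′ →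
         let M≤m = ℕ.m⊔n≤o⇒m≤o M N le ; N≤m = ℕ.m⊔n≤o⇒n≤o M N le
             M≤n = ℕ.m⊔n≤o⇒m≤o M N le′ ; N≤n = ℕ.m⊔n≤o⇒n≤o M N le′
         in half<half (d-* (u m) (v m) (u n) (v n))
              (scaled< 0<K Kδ (u≤K m (ℕ.m⊔n≤o⇒m≤o M₁ M₂ M≤m)) (ℚ.0≤∣p∣ (v m ℚ.- v n))
                (g m n (ℕ.m⊔n≤o⇒m≤o N₁ N₂ N≤m) (ℕ.m⊔n≤o⇒m≤o N₁ N₂ N≤n)))
              (scaled< 0<L Lη (v≤L n (ℕ.m⊔n≤o⇒n≤o M₁ M₂ M≤n)) (ℚ.0≤∣p∣ (u m ℚ.- u n))
                (h m n (ℕ.m⊔n≤o⇒n≤o N₁ N₂ N≤m) (ℕ.m⊔n≤o⇒n≤o N₁ N₂ N≤n)))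

infixl 7 _*_
infixl 6 _+_ _-_

fromℚ : ℚ → ℝ
fromℚ q = mkℝ (λ _ → q) (const-cauchy q)

fromℕ : ℕ → ℝ
fromℕ n = fromℚ (+ n ℚ./ 1)

0ℝ : ℝ
0ℝ = fromℚ 0ℚ

_+_ : ℝ → ℝ → ℝ
x + y = mkℝ (λ n → seq x n ℚ.+ seq y n) (+-cauchy (seq x) (seq y) (cauchy x) (cauchy y))

_-_ : ℝ → ℝ → ℝ
x - y = mkℝ (λ n → seq x n ℚ.- seq y n)
            (+-cauchy (seq x) (λ n → ℚ.- seq y n)
              (cauchy x) (neg-cauchy (seq y) (cauchy y)))

_*_ : ℝ → ℝ → ℝ
x * y = mkℝ (λ n → seq x n ℚ.* seq y n) (*-cauchy (seq x) (seq y) (cauchy x) (cauchy y))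

⌊√_⌋ : ℕ → ℕ
⌊√ zero ⌋  = zero
⌊√ suc n ⌋ with suc ⌊√ n ⌋ ℕ.* suc ⌊√ n ⌋ ℕ.≤? suc n
... | yes _ = suc ⌊√ n ⌋
... | no  _ = ⌊√ n ⌋

⌊√⌋-lower : ∀ n → ⌊√ n ⌋ ℕ.* ⌊√ n ⌋ ℕ.≤ n
⌊√⌋-lower zero = ℕ.z≤n
⌊√⌋-lower (suc n) with suc ⌊√ n ⌋ ℕ.* suc ⌊√ n ⌋ ℕ.≤? suc n
... | yes le = le
... | no  _  = ℕ.m≤n⇒m≤1+n (⌊√⌋-lower n)

⌊√⌋-upper : ∀ n → n ℕ.< suc ⌊√ n ⌋ ℕ.* suc ⌊√ n ⌋
⌊√⌋-upper zero = ℕ.s≤s ℕ.z≤n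
⌊√⌋-upper (suc n) with suc ⌊√ n ⌋ ℕ.* suc ⌊√ n ⌋ ℕ.≤? suc n
... | yes _  = ℕ.≤-<-trans (⌊√⌋-upper n)
                 (ℕ.*-mono-< (ℕ.n<1+n (suc ⌊√ n ⌋)) (ℕ.n<1+n (suc ⌊√ n ⌋)))
... | no  ¬le = ℕ.≰⇒> ¬le

-- The largest multiple of 1/(m+1) whose square is at most n.
√-seq : ℕ → ℕ → ℚ
√-seq n m = + ⌊√ n ℕ.* (suc m ℕ.* suc m) ⌋ ℚ./ suc m

square-cancel-< : ∀ a b → a ℕ.* a ℕ.< b ℕ.* b → a ℕ.< b
square-cancel-< a b a²<b² with ℕ.≤-<-connex b a
... | inj₁ b≤a = contradiction a²<b² (ℕ.≤⇒≯ (ℕ.*-mono-≤ b≤a b≤a))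
... | inj₂ a<b = a<b

/-mono-< : ∀ a b c d → a ℕ.* suc d ℕ.< b ℕ.* suc c →
           + a ℚ./ suc c ℚ.< + b ℚ./ suc d
/-mono-< a b c d lt = ℚ.toℚᵘ-cancel-<
  (ℚᵘ.<-respˡ-≃ (ℚᵘ.≃-sym (ℚ.toℚᵘ-fromℚᵘ (ℚᵘ.mkℚᵘ (+ a) c)))
    (ℚᵘ.<-respʳ-≃ (ℚᵘ.≃-sym (ℚ.toℚᵘ-fromℚᵘ (ℚᵘ.mkℚᵘ (+ b) d)))
      (ℚᵘ.*<* (subst₂ ℤ._<_ (ℤ.pos-* a (suc d)) (ℤ.pos-* b (suc c)) (+<+ lt)))))

/-suc : ∀ a c → + suc a ℚ./ suc c ≡ + a ℚ./ suc c ℚ.+ + 1 ℚ./ suc c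
/-suc a c = ℚ.toℚᵘ-injective (ℚᵘ.≃-trans (ℚ.toℚᵘ-fromℚᵘ (ℚᵘ.mkℚᵘ (+ suc a) c))
  (ℚᵘ.≃-trans core (ℚᵘ.≃-sym (ℚᵘ.≃-trans (ℚ.toℚᵘ-homo-+ (+ a ℚ./ suc c) (+ 1 ℚ./ suc c))
    (ℚᵘ.+-cong (ℚ.toℚᵘ-fromℚᵘ (ℚᵘ.mkℚᵘ (+ a) c)) (ℚ.toℚᵘ-fromℚᵘ (ℚᵘ.mkℚᵘ (+ 1) c)))))))
  where
  open +-*-Solver
  core : ℚᵘ.mkℚᵘ (+ suc a) c ℚᵘ.≃ ℚᵘ.mkℚᵘ (+ a) c ℚᵘ.+ ℚᵘ.mkℚᵘ (+ 1) c
  core = ℚᵘ.*≡* (trans (sym (ℤ.pos-* (suc a) (suc c ℕ.* suc c)))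
    (trans (cong +_ (solve 2 (λ a c →
        (con 1 :+ a) :* (c :* c) := (a :* c :+ con 1 :* c) :* c) refl a (suc c)))
      (trans (ℤ.pos-* (a ℕ.* suc c ℕ.+ 1 ℕ.* suc c) (suc c))
        (cong (ℤ._* + suc c) (trans (ℤ.pos-+ (a ℕ.* suc c) (1 ℕ.* suc c))
          (cong₂ ℤ._+_ (ℤ.pos-* a (suc c)) (ℤ.pos-* 1 (suc c))))))))

√-gap : ∀ n k m → √-seq n k ℚ.< √-seq n m ℚ.+ + 1 ℚ./ suc m
√-gap n k m = subst (√-seq n k ℚ.<_) (/-suc r m)
  (/-mono-< q (suc r) k m (square-cancel-< (q ℕ.* M) (suc r ℕ.* K) (begin-strict
    (q ℕ.* M) ℕ.* (q ℕ.* M)      ≡⟨ sq q M ⟩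
    (q ℕ.* q) ℕ.* (M ℕ.* M)      ≤⟨ ℕ.*-monoˡ-≤ (M ℕ.* M) (⌊√⌋-lower (n ℕ.* (K ℕ.* K))) ⟩
    n ℕ.* (K ℕ.* K) ℕ.* (M ℕ.* M)
      ≡⟨ solve 3 (λ n a b → n :* a :* b := n :* b :* a) refl n (K ℕ.* K) (M ℕ.* M) ⟩
    n ℕ.* (M ℕ.* M) ℕ.* (K ℕ.* K) <⟨ ℕ.*-monoˡ-< (K ℕ.* K) (⌊√⌋-upper (n ℕ.* (M ℕ.* M))) ⟩
    (suc r ℕ.* suc r) ℕ.* (K ℕ.* K) ≡⟨ sym (sq (suc r) K) ⟩
    (suc r ℕ.* K) ℕ.* (suc r ℕ.* K) ∎)))
  where
  open +-*-Solver
  open ℕ.≤-Reasoning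
  K = suc k
  M = suc m
  q = ⌊√ n ℕ.* (K ℕ.* K) ⌋
  r = ⌊√ n ℕ.* (M ℕ.* M) ⌋
  sq : ∀ a b → (a ℕ.* b) ℕ.* (a ℕ.* b) ≡ (a ℕ.* a) ℕ.* (b ℕ.* b)
  sq = solve 2 (λ a b → (a :* b) :* (a :* b) := (a :* a) :* (b :* b)) refl

archimedean : ∀ ε → 0ℚ ℚ.< ε → ∃ λ N → ∀ n → N ℕ.≤ n → + 1 ℚ./ suc n ℚ.< ε
archimedean (mkℚ (+ zero) d c) (*<* (+<+ ()))
archimedean ε@(mkℚ (+ suc p) d c) _ = suc d , λ n d<n →
  subst (+ 1 ℚ./ suc n ℚ.<_) (ℚ.fromℚᵘ-toℚᵘ ε)
    (/-mono-< 1 (suc p) n d (ℕ.<-≤-trans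
      (subst (ℕ._< suc n) (sym (ℕ.*-identityˡ (suc d))) (ℕ.s≤s d<n))
      (ℕ.m≤m+n (suc n) (p ℕ.* suc n))))

diff< : ∀ {p q δ} → p ℚ.< q ℚ.+ δ → q ℚ.< p ℚ.+ δ → ℚ.∣ p ℚ.- q ∣ ℚ.< δ
diff< {p} {q} {δ} p< q< with ℚ.∣p∣≡p∨∣p∣≡-p (p ℚ.- q)
... | inj₁ eq = subst (ℚ._< δ) (sym eq) (subst (p ℚ.- q ℚ.<_)
      (R.solve 2 (λ q δ → q R.:+ δ R.:- q R.:= δ) refl q δ) (ℚ.+-monoˡ-< (ℚ.- q) p<))
... | inj₂ eq = subst (ℚ._< δ) (sym eq) (subst₂ ℚ._<_
      (R.solve 2 (λ p q → q R.:- p R.:= R.:- (p R.:- q)) refl p q)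
      (R.solve 2 (λ p δ → p R.:+ δ R.:- p R.:= δ) refl p δ) (ℚ.+-monoˡ-< (ℚ.- p) q<))

abstract
  √-cauchy : ∀ n → IsCauchy (√-seq n)
  √-cauchy n ε 0<ε with archimedean ε 0<ε
  ... | N , small = N , λ k m N≤k N≤m → diff<
    (ℚ.<-trans (√-gap n k m) (ℚ.+-monoʳ-< (√-seq n m) (small m N≤m)))
    (ℚ.<-trans (√-gap n m k) (ℚ.+-monoʳ-< (√-seq n k) (small k N≤k)))

√_ : ℕ → ℝ
√ n = mkℝ (√-seq n) (√-cauchy n)

infix 9 √_

√-nonNeg : ∀ n → 0ℝ ≤ √ n
√-nonNeg n (mk< (ε , 0<ε , N , h)) = ℚ.<-irrefl refl (ℚ.<-≤-trans 0<ε (ℚ.≤-trans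
  (subst (ℚ._≤ q ℚ.+ ε) (ℚ.+-identityˡ ε) (ℚ.+-monoˡ-≤ ε 0≤q)) (h N ℕ.≤-refl)))
  where
  q = √-seq n N
  0≤q : 0ℚ ℚ.≤ q
  0≤q = ℚ.nonNegative⁻¹ q ⦃ ℚ.normalize-nonNeg ⌊√ n ℕ.* (suc N ℕ.* suc N) ⌋ (suc N) ⦄

toℚᵘ-square : ∀ a c → ℚ.toℚᵘ (+ a ℚ./ suc c ℚ.* (+ a ℚ./ suc c))
                        ℚᵘ.≃ ℚᵘ.mkℚᵘ (+ a) c ℚᵘ.* ℚᵘ.mkℚᵘ (+ a) c
toℚᵘ-square a c = ℚᵘ.≃-trans (ℚ.toℚᵘ-homo-* (+ a ℚ./ suc c) (+ a ℚ./ suc c))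
  (ℚᵘ.*-cong (ℚ.toℚᵘ-fromℚᵘ (ℚᵘ.mkℚᵘ (+ a) c)) (ℚ.toℚᵘ-fromℚᵘ (ℚᵘ.mkℚᵘ (+ a) c)))

√-seq-lower : ∀ n m → √-seq n m ℚ.* √-seq n m ℚ.≤ + n ℚ./ 1
√-seq-lower n m = ℚ.toℚᵘ-cancel-≤
  (ℚᵘ.≤-respˡ-≃ (ℚᵘ.≃-sym (toℚᵘ-square q m))
    (ℚᵘ.≤-respʳ-≃ (ℚᵘ.≃-sym (ℚ.toℚᵘ-fromℚᵘ (ℚᵘ.mkℚᵘ (+ n) 0)))
      (ℚᵘ.*≤* (subst₂ ℤ._≤_
        (trans (ℤ.pos-* (q ℕ.* q) 1) (cong (ℤ._* + 1) (ℤ.pos-* q q)))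
        (ℤ.pos-* n (M ℕ.* M))
        (ℤ.+≤+ (subst (ℕ._≤ n ℕ.* (M ℕ.* M)) (sym (ℕ.*-identityʳ (q ℕ.* q)))
          (⌊√⌋-lower (n ℕ.* (M ℕ.* M)))))))))
  where
  M = suc m
  q = ⌊√ n ℕ.* (M ℕ.* M) ⌋

√-seq-upper : ∀ n m → let t = √-seq n m ℚ.+ + 1 ℚ./ suc m in + n ℚ./ 1 ℚ.< t ℚ.* t
√-seq-upper n m = subst (λ t → + n ℚ./ 1 ℚ.< t ℚ.* t) (/-suc q m) (ℚ.toℚᵘ-cancel-<
  (ℚᵘ.<-respʳ-≃ (ℚᵘ.≃-sym (toℚᵘ-square (suc q) m))
    (ℚᵘ.<-respˡ-≃ (ℚᵘ.≃-sym (ℚ.toℚᵘ-fromℚᵘ (ℚᵘ.mkℚᵘ (+ n) 0)))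
      (ℚᵘ.*<* (subst₂ ℤ._<_
        (ℤ.pos-* n (M ℕ.* M))
        (trans (ℤ.pos-* (suc q ℕ.* suc q) 1) (cong (ℤ._* + 1) (ℤ.pos-* (suc q) (suc q))))
        (+<+ (subst (n ℕ.* (M ℕ.* M) ℕ.<_) (sym (ℕ.*-identityʳ (suc q ℕ.* suc q)))
          (⌊√⌋-upper (n ℕ.* (M ℕ.* M))))))))))
  where
  M = suc m
  q = ⌊√ n ℕ.* (M ℕ.* M) ⌋

√-square : ∀ n → √ n * √ n ≈ fromℕ n
√-square n = mk≈ λ ε 0<ε →
  let K , N₁ , 0<K , s≤K = bounded (√-seq n) (√-cauchy n)
      L = (K ℚ.+ K) ℚ.+ 1ℚ
      0<L = ℚ.+-mono-< (ℚ.+-mono-< 0<K 0<K) (ℚ.positive⁻¹ 1ℚ)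
      η , 0<η , Lη = quotient 0<ε 0<L
      N₂ , small₁ = archimedean 1ℚ (ℚ.positive⁻¹ 1ℚ)
      N₃ , small₂ = archimedean η 0<η
  in N₁ ℕ.⊔ (N₂ ℕ.⊔ N₃) , λ m le →
    let s  = √-seq n m
        δ  = + 1 ℚ./ suc m
        0≤δ = ℚ.nonNegative⁻¹ δ ⦃ ℚ.normalize-nonNeg 1 (suc m) ⦄
        le′ = ℕ.m⊔n≤o⇒n≤o N₁ (N₂ ℕ.⊔ N₃) le
        s≤ = ℚ.≤-trans (p≤∣p∣ s) (s≤K m (ℕ.m⊔n≤o⇒m≤o N₁ (N₂ ℕ.⊔ N₃) le))
        δ≤1 = ℚ.<⇒≤ (small₁ m (ℕ.m⊔n≤o⇒m≤o N₂ N₃ le′))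
        δ<η = small₂ m (ℕ.m⊔n≤o⇒n≤o N₂ N₃ le′)
        slack : ((s ℚ.+ s) ℚ.+ δ) ℚ.* δ ℚ.< ε
        slack = scaled< 0<L Lη (ℚ.+-mono-≤ (ℚ.+-mono-≤ s≤ s≤) δ≤1) 0≤δ δ<η
    in diff<
      (ℚ.≤-<-trans (√-seq-lower n m)
        (subst (ℚ._< + n ℚ./ 1 ℚ.+ ε) (ℚ.+-identityʳ (+ n ℚ./ 1))
          (ℚ.+-monoʳ-< (+ n ℚ./ 1) 0<ε)))
      (ℚ.<-trans (√-seq-upper n m) (subst (ℚ._< s ℚ.* s ℚ.+ ε)
        (R.solve 2 (λ s δ →
          s R.:* s R.:+ ((s R.:+ s) R.:+ δ) R.:* δ R.:= (s R.:+ δ) R.:* (s R.:+ δ))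
          refl s δ)
        (ℚ.+-monoʳ-< (s ℚ.* s) slack)))
  where
  p≤∣p∣ : ∀ p → p ℚ.≤ ℚ.∣ p ∣
  p≤∣p∣ p with ℚ.≤-total 0ℚ p
  ... | inj₁ 0≤p = ℚ.≤-reflexive (sym (ℚ.0≤p⇒∣p∣≡p 0≤p))
  ... | inj₂ p≤0 = ℚ.≤-trans p≤0 (ℚ.0≤∣p∣ p)

range : ∀ {n} → (Fin n → ℝ) → Pred ℝ 0ℓ
range a x = ∃ λ i → x ≈ a i

HasCardinality : Pred ℝ 0ℓ → ℕ → Set
HasCardinality X n = Σ (Fin n → ℝ) λ e → Injective _≡_ _≈_ e × X ≐ range e

infixl 6 _⊕_

_⊕_ : Pred ℝ 0ℓ → Pred ℝ 0ℓ → Pred ℝ 0ℓ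
(X ⊕ Y) z = ∃₂ λ x y → X x × Y y × z ≈ x + y

-- Equality of reals is not decidable, so the cardinality of a sumset cannot be
-- computed; that a finite sumset has one holds up to double negation.
range-cardinality : ∀ {n} (a : Fin n → ℝ) → ¬ ¬ ∃ (HasCardinality (range a))
range-cardinality {zero} a ¬h =
  ¬h (0 , a , (λ { {()} }) , (λ p → p) , (λ p → p))
range-cardinality {suc n} a ¬h = range-cardinality (a ∘ suc) λ (m , e , inj , ⊆e , e⊆) →
  ¬¬-excluded-middle {A = range e (a zero)} λ
  { (yes (i , a₀≈eᵢ)) → ¬h (m , e , inj
      , (λ { (zero , x≈) → i , E.trans x≈ a₀≈eᵢ ; (suc j , x≈) → ⊆e (j , x≈) })
      , λ p → let j , x≈ = e⊆ p in suc j , x≈)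
  ; (no a₀∉e) → ¬h (suc m , cons (a zero) e
      , (λ { {zero} {zero} _ → refl
           ; {zero} {suc j} a₀≈ → contradiction (j , a₀≈) a₀∉e
           ; {suc i} {zero} ≈a₀ → contradiction (i , E.sym ≈a₀) a₀∉e
           ; {suc i} {suc j} eq → cong suc (inj eq) })
      , (λ { (zero , x≈) → zero , x≈
           ; (suc j , x≈) → let i , x≈′ = ⊆e (j , x≈) in suc i , x≈′ })
      , (λ { (zero , x≈) → zero , x≈
           ; (suc i , x≈) → let j , x≈′ = e⊆ (i , x≈) in suc j , x≈′ })) }
  where
  module E = IsEquivalence ≈-isEquivalence
  cons : ∀ {m} → ℝ → (Fin m → ℝ) → Fin (suc m) → ℝ
  cons x e zero    = x
  cons x e (suc i) = e i

+-cong : ∀ {x x′ y y′} → x ≈ x′ → y ≈ y′ → x + y ≈ x′ + y′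
+-cong {x} {x′} {y} {y′} x≈ y≈ = mk≈ λ ε 0<ε →
  let M , g = close x≈ (½ ℚ.* ε) (½-pos 0<ε)
      N , h = close y≈ (½ ℚ.* ε) (½-pos 0<ε)
  in M ℕ.⊔ N , λ n le →
       half<half (d-+ (seq x n) (seq y n) (seq x′ n) (seq y′ n))
         (g n (ℕ.m⊔n≤o⇒m≤o M N le)) (h n (ℕ.m⊔n≤o⇒n≤o M N le))

⊕-cardinality : ∀ {X Y m n} → HasCardinality X m → HasCardinality Y n →
                ¬ ¬ ∃ (HasCardinality (X ⊕ Y))
⊕-cardinality {X} {Y} {m} {n} (e , _ , X⊆ , ⊆X) (f , _ , Y⊆ , ⊆Y) ¬h =
  range-cardinality sums λ (s , g , inj , ⊆g , g⊆) →
    ¬h (s , g , inj , (λ p → ⊆g (to p)) , (λ p → from (g⊆ p)))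
  where
  module E = IsEquivalence ≈-isEquivalence
  sums : Fin (m ℕ.* n) → ℝ
  sums k = e (proj₁ (Fin.remQuot {m} n k)) + f (proj₂ (Fin.remQuot {m} n k))
  to : ∀ {z} → (X ⊕ Y) z → range sums z
  to {z} (x , y , Xx , Yy , z≈) = let i , x≈ = X⊆ Xx ; j , y≈ = Y⊆ Yy in
    Fin.combine i j ,
    subst (λ p → z ≈ e (proj₁ p) + f (proj₂ p)) (sym (Fin.remQuot-combine i j))
      (E.trans z≈ (+-cong x≈ y≈))
  from : ∀ {z} → range sums z → (X ⊕ Y) z
  from (k , z≈) = _ , _ , ⊆X (_ , E.refl) , ⊆Y (_ , E.refl) , z≈

StrictlyIncreasing : ∀ {k} → (Fin k → ℝ) → Set
StrictlyIncreasing a = ∀ i j → i Fin.< j → a i < a j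

difference : ∀ {k} → (Fin k → ℝ) → Fin (ℕ.pred k) → ℝ
difference {suc _} a i = a (suc i) - a (inject₁ i)

DistinctDifferencePairs : ∀ {k} → (Fin k → ℝ) → (Fin k → ℝ) → Set
DistinctDifferencePairs a a′ = ∀ i j → i ≢ j →
  ¬ (difference a i ≈ difference a j × difference a′ i ≈ difference a′ j)

{-# OPTIONS --safe #-}
module Submission where

-- Write n = k − 1. In increasing order of A + B, the k elements of a translate
-- A + b are separated by n gaps of total length at most |A + B|, and likewise
-- for A′ + b′. By Markov's inequality, for at least n/2 indices i both the gap
-- from aᵢ + b to aᵢ₊₁ + b and the one from a′ᵢ + b′ to a′ᵢ₊₁ + b′ are short: at
-- most 4|A + B|/n and 4|A′ + B′|/n. The two pairs of sums determine the pair of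
-- differences (dᵢ, d′ᵢ), hence i, b and b′, so counting pairs at short distance
-- gives |B||B′| n/2 ≤ |A + B| (4|A + B|/n) |A′ + B′| (4|A′ + B′|/n), and
-- k ≤ 2n turns this into k³|B||B′| ≤ 16² (|A + B||A′ + B′|)² for k ≥ 2.
-- The order on ℝ is undecidable, but the inequality is between natural numbers
-- and so may be proved under a double negation.

open import Data.Nat as ℕ using (ℕ; zero; suc; _^_; _∸_; NonZero)
import Data.Nat.Properties as ℕ
import Data.Nat.DivMod as ℕ
import Data.Nat.Solver as ℕ-Solver
open import Data.Integer as ℤ using (+_)
import Data.Integer.Properties as ℤ
open import Data.Rational as ℚ using (ℚ; 0ℚ; ½)
import Data.Rational.Properties as ℚ
import Data.Rational.Solver as ℚ-Solver
import Data.Rational.Unnormalised as ℚᵘ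
import Data.Rational.Unnormalised.Properties as ℚᵘ
open import Data.Fin as Fin using (Fin; zero; suc; inject₁; toℕ; fromℕ<)
import Data.Fin.Properties as Fin
open import Data.Fin.Subset using (Subset; _∈_; _⊂_; ∣_∣)
import Data.Fin.Subset.Properties as Subset
import Data.Vec as Vec
import Data.Vec.Properties as Vec
open import Data.Product using (_×_; ∃; ∃-syntax; _,_; proj₁; proj₂; uncurry)
open import Data.Sum using (inj₁; inj₂)
open import Effect.Monad using (RawMonad)
open import Function using (_∘_)
open import Function.Definitions using (Injective)
open import Level using (0ℓ)
open import Relation.Binary using (IsEquivalence)
open import Relation.Binary.PropositionalEquality
  using (_≡_; refl; sym; trans; cong; cong₂; subst; subst₂)
open import Relation.Nullary using (¬_; Dec; does; yes; no)
open import Relation.Nullary.Decidable using (decidable-stable; dec-true; ¬¬-excluded-middle)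
open import Relation.Nullary.Negation using (¬¬-Monad)
open import Relation.Unary using (Pred; Satisfiable)
open import Algebra.Properties.Semiring.Sum ℕ.+-*-semiring
  using (sum; *-distribˡ-sum; *-distribʳ-sum)
open import Algebra.Properties.CommutativeMonoid.Sum ℕ.+-0-commutativeMonoid
  using (∑-distrib-+)
open import Algebra.Properties.CommutativeSemigroup ℕ.+-commutativeSemigroup
  using (x∙yz≈y∙xz)
open import Defs

-- Order and arithmetic of Cauchy reals

module ≈ = IsEquivalence ≈-isEquivalence
module R = ℚ-Solver.+-*-Solver
module N = ℕ-Solver.+-*-Solver

p≤∣p∣ : ∀ p → p ℚ.≤ ℚ.∣ p ∣
p≤∣p∣ p with ℚ.≤-total 0ℚ p
... | inj₁ 0≤p = ℚ.≤-reflexive (sym (ℚ.0≤p⇒∣p∣≡p 0≤p))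
... | inj₂ p≤0 = ℚ.≤-trans p≤0 (ℚ.0≤∣p∣ p)

∣p-q∣<δ⇒p≤q+δ : ∀ p q {δ} → ℚ.∣ p ℚ.- q ∣ ℚ.< δ → p ℚ.≤ q ℚ.+ δ
∣p-q∣<δ⇒p≤q+δ p q {δ} lt = subst (ℚ._≤ q ℚ.+ δ)
  (R.solve 2 (λ p q → q R.:+ (p R.:- q) R.:= p) refl p q)
  (ℚ.+-monoʳ-≤ q (ℚ.≤-trans (p≤∣p∣ (p ℚ.- q)) (ℚ.<⇒≤ lt)))

¼ : ℚ → ℚ
¼ ε = ½ ℚ.* (½ ℚ.* ε)

¼-pos : ∀ {ε} → 0ℚ ℚ.< ε → 0ℚ ℚ.< ¼ ε
¼-pos 0<ε = ½-pos (½-pos 0<ε)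

-- Errors of `¼ ε` at both ends use up half of the separation `ε` and leave the other half. This
-- serves both to replace reals by equal ones and to move along a Cauchy sequence.
separated-perturb : ∀ p {p′} q {q′} ε → p′ ℚ.≤ p ℚ.+ ¼ ε → q ℚ.≤ q′ ℚ.+ ¼ ε →
                    p ℚ.+ ε ℚ.≤ q → p′ ℚ.+ ½ ℚ.* ε ℚ.≤ q′
separated-perturb p {p′} q {q′} ε p′≤ q≤ p+ε≤q = begin
  p′ ℚ.+ ½ ℚ.* ε               ≤⟨ ℚ.+-monoˡ-≤ (½ ℚ.* ε) p′≤ ⟩
  p ℚ.+ ¼ ε ℚ.+ ½ ℚ.* ε        ≡⟨ cong (λ t → p ℚ.+ ¼ ε ℚ.+ t) (sym (½-split (½ ℚ.* ε))) ⟩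
  p ℚ.+ δ ℚ.+ (δ ℚ.+ δ)        ≡⟨ R.solve 2 (λ p δ →
                                    p R.:+ δ R.:+ (δ R.:+ δ)
                                    R.:= p R.:+ (δ R.:+ δ R.:+ (δ R.:+ δ)) R.:- δ) refl p δ ⟩
  p ℚ.+ (δ ℚ.+ δ ℚ.+ (δ ℚ.+ δ)) ℚ.- δ ≡⟨ cong (λ t → p ℚ.+ t ℚ.- δ)
                                    (trans (cong (λ t → t ℚ.+ t) (½-split (½ ℚ.* ε))) (½-split ε)) ⟩
  p ℚ.+ ε ℚ.- δ                ≤⟨ ℚ.+-monoˡ-≤ (ℚ.- δ) (ℚ.≤-trans p+ε≤q q≤) ⟩
  q′ ℚ.+ δ ℚ.- δ               ≡⟨ R.solve 2 (λ q δ → q R.:+ δ R.:- δ R.:= q) refl q′ δ ⟩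
  q′                           ∎
  where
  open ℚ.≤-Reasoning
  δ = ¼ ε

≗⇒≈ : ∀ {x y} → (∀ n → seq x n ≡ seq y n) → x ≈ y
≗⇒≈ {x} {y} eq = mk≈ λ ε 0<ε → 0 , λ n _ →
  subst (λ t → ℚ.∣ seq x n ℚ.- t ∣ ℚ.< ε) (eq n) (d-refl (seq x n) 0<ε)

sub-cong : ∀ {x x′ y y′} → x ≈ x′ → y ≈ y′ → x - y ≈ x′ - y′
sub-cong {x} {x′} {y} {y′} x≈ y≈ = +-cong x≈ (neg y y′ y≈)
  where
  neg : ∀ y y′ → y ≈ y′ → mkℝ (λ n → ℚ.- seq y n) (neg-cauchy (seq y) (cauchy y))
                        ≈ mkℝ (λ n → ℚ.- seq y′ n) (neg-cauchy (seq y′) (cauchy y′))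
  neg y y′ y≈ = mk≈ λ ε 0<ε → let N , h = close y≈ ε 0<ε in
    N , λ n le → subst (ℚ._< ε) (sym (d-neg (seq y n) (seq y′ n))) (h n le)

+-cancelˡ : ∀ x {y z} → x + y ≈ x + z → y ≈ z
+-cancelˡ x {y} {z} eq = ≈.trans (≈.sym (cancel y))
  (≈.trans (sub-cong eq (≈.refl {x})) (cancel z))
  where
  cancel : ∀ y → (x + y) - x ≈ y
  cancel y = ≗⇒≈ λ n → R.solve 2 (λ p q → p R.:+ q R.:- p R.:= q) refl (seq x n) (seq y n)

translates-difference : ∀ {x x′ b y y′ c} → x + b ≈ y + c → x′ + b ≈ y′ + c →
                        x′ - x ≈ y′ - y
translates-difference {x} {x′} {b} {y} {y′} {c} eq eq′ =
  ≈.trans (≈.sym (cancel x x′ b)) (≈.trans (sub-cong eq′ eq) (cancel y y′ c))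
  where
  cancel : ∀ x x′ b → (x′ + b) - (x + b) ≈ x′ - x
  cancel x x′ b = ≗⇒≈ λ n → R.solve 3 (λ p q r →
    (q R.:+ r) R.:- (p R.:+ r) R.:= q R.:- p) refl (seq x n) (seq x′ n) (seq b n)

<-irrefl : ∀ {x} → ¬ x < x
<-irrefl {x} (mk< (ε , 0<ε , N , h)) = ℚ.<-irrefl refl (ℚ.<-≤-trans
  (subst (ℚ._< seq x N ℚ.+ ε) (ℚ.+-identityʳ (seq x N)) (ℚ.+-monoʳ-< (seq x N) 0<ε))
  (h N ℕ.≤-refl))

<-trans : ∀ {x y z} → x < y → y < z → x < z
<-trans {x} {y} {z} (mk< (ε , 0<ε , M , g)) (mk< (η , 0<η , N , h)) =
  mk< (ε , 0<ε , M ℕ.⊔ N , λ n le → ℚ.≤-trans (g n (ℕ.m⊔n≤o⇒m≤o M N le))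
    (ℚ.≤-trans
      (subst (ℚ._≤ seq y n ℚ.+ η) (ℚ.+-identityʳ (seq y n)) (ℚ.+-monoʳ-≤ (seq y n) (ℚ.<⇒≤ 0<η)))
      (h n (ℕ.m⊔n≤o⇒n≤o M N le))))

<-resp-≈ : ∀ {x x′ y y′} → x ≈ x′ → y ≈ y′ → x < y → x′ < y′
<-resp-≈ {x} {x′} {y} {y′} x≈ y≈ (mk< (ε , 0<ε , L , f)) =
  let M , g = close (≈.sym x≈) (¼ ε) (¼-pos 0<ε)
      N , h = close y≈ (¼ ε) (¼-pos 0<ε)
  in mk< (½ ℚ.* ε , ½-pos 0<ε , L ℕ.⊔ (M ℕ.⊔ N) , λ n le →
       let le′ = ℕ.m⊔n≤o⇒n≤o L (M ℕ.⊔ N) le in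
       separated-perturb (seq x n) (seq y n) ε
         (∣p-q∣<δ⇒p≤q+δ (seq x′ n) (seq x n) (g n (ℕ.m⊔n≤o⇒m≤o M N le′)))
         (∣p-q∣<δ⇒p≤q+δ (seq y n) (seq y′ n) (h n (ℕ.m⊔n≤o⇒n≤o M N le′)))
         (f n (ℕ.m⊔n≤o⇒m≤o L (M ℕ.⊔ N) le)))

+-monoˡ-< : ∀ z {x y} → x < y → x + z < y + z
+-monoˡ-< z {x} {y} (mk< (ε , 0<ε , N , h)) = mk< (ε , 0<ε , N , λ n le →
  subst (ℚ._≤ seq y n ℚ.+ seq z n)
    (R.solve 3 (λ p q ε → p R.:+ ε R.:+ q R.:= p R.:+ q R.:+ ε) refl (seq x n) (seq z n) ε)
    (ℚ.+-monoˡ-≤ (seq z n) (h n le)))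

-- A negated `<` supplies no index, so the index comes from the two Cauchy moduli. A failure at a
-- single `n` past it would persist, with margin `½ ℚ.* ε`, at all later indices and so prove
-- `y < x`; decidability of the order on ℚ then yields the positive claim.
≮⇒eventually : ∀ {x y} → ¬ y < x → ∀ ε → 0ℚ ℚ.< ε →
               ∃ λ N → ∀ n → N ℕ.≤ n → seq x n ℚ.< seq y n ℚ.+ ε
≮⇒eventually {x} {y} y≮x ε 0<ε =
  let M , g = cauchy x (¼ ε) (¼-pos 0<ε)
      N , h = cauchy y (¼ ε) (¼-pos 0<ε)
  in M ℕ.⊔ N , λ n le → decidable-stable (seq x n ℚ.<? seq y n ℚ.+ ε) λ ¬lt →
       y≮x (mk< (½ ℚ.* ε , ½-pos 0<ε , M ℕ.⊔ N , λ m le′ → separated-perturb (seq y n) (seq x n) ε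
         (∣p-q∣<δ⇒p≤q+δ (seq y m) (seq y n)
           (h m n (ℕ.m⊔n≤o⇒n≤o M N le′) (ℕ.m⊔n≤o⇒n≤o M N le)))
         (∣p-q∣<δ⇒p≤q+δ (seq x n) (seq x m)
           (g n m (ℕ.m⊔n≤o⇒m≤o M N le) (ℕ.m⊔n≤o⇒m≤o M N le′)))
         (ℚ.≮⇒≥ ¬lt)))

-- Tightness of the order: it turns the incomparability of two sums of equal rank into an equality
-- of reals.
≮∧≯⇒≈ : ∀ {x y} → ¬ x < y → ¬ y < x → x ≈ y
≮∧≯⇒≈ x≮y y≮x = mk≈ λ ε 0<ε →
  let M , g = ≮⇒eventually y≮x ε 0<ε
      N , h = ≮⇒eventually x≮y ε 0<ε
  in M ℕ.⊔ N , λ n le → diff< (g n (ℕ.m⊔n≤o⇒m≤o M N le)) (h n (ℕ.m⊔n≤o⇒n≤o M N le))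

-- Bounding square roots by natural numbers

/1-* : ∀ a b → + (a ℕ.* b) ℚ./ 1 ≡ + a ℚ./ 1 ℚ.* (+ b ℚ./ 1)
/1-* a b = trans (cong (ℚ._/ 1) (ℤ.pos-* a b)) (ℚ.toℚᵘ-injective
  (ℚᵘ.≃-trans (ℚ.toℚᵘ-fromℚᵘ (ℚᵘ.mkℚᵘ (+ a ℤ.* + b) 0))
    (ℚᵘ.≃-sym (ℚᵘ.≃-trans (ℚ.toℚᵘ-homo-* (+ a ℚ./ 1) (+ b ℚ./ 1))
      (ℚᵘ.*-cong (ℚ.toℚᵘ-fromℚᵘ (ℚᵘ.mkℚᵘ (+ a) 0)) (ℚ.toℚᵘ-fromℚᵘ (ℚᵘ.mkℚᵘ (+ b) 0)))))))

/1-mono-≤ : ∀ {a b} → a ℕ.≤ b → + a ℚ./ 1 ℚ.≤ + b ℚ./ 1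
/1-mono-≤ {a} {b} a≤b with ℕ.m≤n⇒m<n∨m≡n a≤b
... | inj₁ a<b  = ℚ.<⇒≤ (/-mono-< a b 0 0 (ℕ.*-monoˡ-< 1 a<b))
... | inj₂ refl = ℚ.≤-refl

-- A term `t` above `r` would give r² < t² ≤ n ≤ r². The bound holds for each approximation
-- separately, not only in the limit.
√-seq≤ : ∀ {n r} → n ℕ.≤ r ℕ.* r → ∀ m → √-seq n m ℚ.≤ + r ℚ./ 1
√-seq≤ {n} {r} n≤r² m = ℚ.≮⇒≥ λ q<√ → ℚ.<-irrefl refl (begin-strict
  q ℚ.* q       ≤⟨ ℚ.*-monoˡ-≤-nonNeg q ⦃ nn ⦄ (ℚ.<⇒≤ q<√) ⟩
  q ℚ.* t       <⟨ ℚ.*-monoˡ-<-pos t ⦃ ℚ.positive (ℚ.≤-<-trans (ℚ.nonNegative⁻¹ q ⦃ nn ⦄) q<√) ⦄ q<√ ⟩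
  t ℚ.* t       ≤⟨ √-seq-lower n m ⟩
  + n ℚ./ 1     ≤⟨ /1-mono-≤ n≤r² ⟩
  + (r ℕ.* r) ℚ./ 1 ≡⟨ /1-* r r ⟩
  q ℚ.* q       ∎)
  where
  open ℚ.≤-Reasoning
  q = + r ℚ./ 1
  t = √-seq n m
  nn = ℚ.normalize-nonNeg r 1

sixteenth-√≤ : ∀ {n s} → n ℕ.≤ 256 ℕ.* (s ℕ.* s) → fromℚ (+ 1 ℚ./ 16) * √ n ≤ fromℕ s
sixteenth-√≤ {n} {s} n≤ (mk< (ε , 0<ε , N , h)) = ℚ.<-irrefl refl (begin-strict
  S                                  ≡⟨ sym (ℚ.+-identityʳ S) ⟩
  S ℚ.+ 0ℚ                           <⟨ ℚ.+-monoʳ-< S 0<ε ⟩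
  S ℚ.+ ε                            ≤⟨ h N ℕ.≤-refl ⟩
  + 1 ℚ./ 16 ℚ.* √-seq n N           ≤⟨ ℚ.*-monoˡ-≤-nonNeg (+ 1 ℚ./ 16) (√-seq≤ {r = 16 ℕ.* s} n≤′ N) ⟩
  + 1 ℚ./ 16 ℚ.* (+ (16 ℕ.* s) ℚ./ 1) ≡⟨ cong (+ 1 ℚ./ 16 ℚ.*_) (/1-* 16 s) ⟩
  + 1 ℚ./ 16 ℚ.* (+ 16 ℚ./ 1 ℚ.* S)   ≡⟨ sym (ℚ.*-assoc (+ 1 ℚ./ 16) (+ 16 ℚ./ 1) S) ⟩
  -- The first product evaluates to `1ℚ`, so the identity law applies.
  + 1 ℚ./ 16 ℚ.* (+ 16 ℚ./ 1) ℚ.* S   ≡⟨ ℚ.*-identityˡ S ⟩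
  S                                  ∎)
  where
  open ℚ.≤-Reasoning
  S = + s ℚ./ 1
  n≤′ : n ℕ.≤ (16 ℕ.* s) ℕ.* (16 ℕ.* s)
  n≤′ = ℕ.≤-trans n≤ (ℕ.≤-reflexive (N.solve 1 (λ s →
    N.con 256 N.:* (s N.:* s) N.:= (N.con 16 N.:* s) N.:* (N.con 16 N.:* s)) refl s))

-- Counting pairs at short distance

-- Counting predecessors maps a decidable strict order monotonically into `Fin s`. Equal ranks give
-- incomparability only; its translation into equality is left to the order at hand.
module Rank {s} (_≺_ : Fin s → Fin s → Set) (_≺?_ : ∀ i j → Dec (i ≺ j))
            (irrefl : ∀ {i} → ¬ i ≺ i) (≺-trans : ∀ {i j k} → i ≺ j → j ≺ k → i ≺ k) where

  below : Fin s → Subset s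
  below j = Vec.tabulate λ i → does (i ≺? j)

  ∈-below⁺ : ∀ {i j} → i ≺ j → i ∈ below j
  ∈-below⁺ {i} {j} i≺j = Vec.lookup⇒[]= i (below j)
    (trans (Vec.lookup∘tabulate _ i) (dec-true (i ≺? j) i≺j))

  ∈-below⁻ : ∀ {i j} → i ∈ below j → i ≺ j
  ∈-below⁻ {i} {j} i∈ with i ≺? j | trans (sym (Vec.lookup∘tabulate (λ i → does (i ≺? j)) i)) (Vec.[]=⇒lookup i∈)
  ... | yes i≺j | _ = i≺j

  below-⊂ : ∀ {i j} → i ≺ j → below i ⊂ below j
  below-⊂ {i} i≺j = (λ k∈ → ∈-below⁺ (≺-trans (∈-below⁻ k∈) i≺j)) ,
    i , ∈-below⁺ i≺j , irrefl ∘ ∈-below⁻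

  ∣below∣<s : ∀ i → ∣ below i ∣ ℕ.< s
  ∣below∣<s i = subst (∣ below i ∣ ℕ.<_) (Subset.∣⊤∣≡n s)
    (Subset.p⊂q⇒∣p∣<∣q∣ (Subset.⊆⊤ , i , Subset.∈⊤ , irrefl ∘ ∈-below⁻))

  rank : Fin s → Fin s
  rank i = fromℕ< (∣below∣<s i)

  rank-mono : ∀ {i j} → i ≺ j → rank i Fin.< rank j
  rank-mono {i} {j} i≺j = subst₂ ℕ._<_
    (sym (Fin.toℕ-fromℕ< (∣below∣<s i))) (sym (Fin.toℕ-fromℕ< (∣below∣<s j)))
    (Subset.p⊂q⇒∣p∣<∣q∣ (below-⊂ i≺j))

  rank≡⇒⊀ : ∀ {i j} → rank i ≡ rank j → ¬ i ≺ j
  rank≡⇒⊀ eq i≺j = Fin.<-irrefl eq (rank-mono i≺j)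

-- The injection `sel` enumerates the indices of weight at most `T`. Each of the other n - p weights
-- exceeds `T`, so (n - p) T is at most the total weight; the inequality is stated additively to
-- avoid truncated subtraction.
markov : ∀ {n} (w : Fin n → ℕ) T → ∃ λ p → ∃ λ (sel : Fin p → Fin n) →
         Injective _≡_ _≡_ sel × (∀ j → w (sel j) ℕ.≤ T) × n ℕ.* T ℕ.≤ p ℕ.* T ℕ.+ sum w
markov {zero}  w T = 0 , (λ ()) , (λ { {()} }) , (λ ()) , ℕ.z≤n
markov {suc n} w T with markov (w ∘ suc) T | w zero ℕ.≤? T
... | p , sel , inj , light , n*T≤ | no w₀≰T =
  p , suc ∘ sel , inj ∘ Fin.suc-injective , light , (begin
    T ℕ.+ n ℕ.* T                       ≤⟨ ℕ.+-mono-≤ (ℕ.<⇒≤ (ℕ.≰⇒> w₀≰T)) n*T≤ ⟩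
    w zero ℕ.+ (p ℕ.* T ℕ.+ sum (w ∘ suc)) ≡⟨ x∙yz≈y∙xz (w zero) (p ℕ.* T) _ ⟩
    p ℕ.* T ℕ.+ sum w                   ∎)
  where
  open ℕ.≤-Reasoning
... | p , sel , inj , light , n*T≤ | yes w₀≤T =
  suc p , Fin.lift 1 sel , Fin.lift-injective sel inj 1 ,
  (λ { zero → w₀≤T ; (suc j) → light j }) , (begin
    T ℕ.+ n ℕ.* T                         ≤⟨ ℕ.+-monoʳ-≤ T n*T≤ ⟩
    T ℕ.+ (p ℕ.* T ℕ.+ sum (w ∘ suc))     ≡⟨ sym (ℕ.+-assoc T (p ℕ.* T) _) ⟩
    T ℕ.+ p ℕ.* T ℕ.+ sum (w ∘ suc)       ≤⟨ ℕ.+-monoʳ-≤ (T ℕ.+ p ℕ.* T) (ℕ.m≤n+m _ (w zero)) ⟩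
    T ℕ.+ p ℕ.* T ℕ.+ sum w               ∎)
  where open ℕ.≤-Reasoning

gap : ∀ {n s} → (Fin (suc n) → Fin s) → Fin n → ℕ
gap f i = toℕ (f (suc i)) ∸ toℕ (f (inject₁ i))

Increasing : ∀ {n s} → (Fin (suc n) → Fin s) → Set
Increasing f = ∀ i → f (inject₁ i) Fin.< f (suc i)

-- The gaps telescope. Keeping the first position on the left lets the induction absorb one gap at a
-- time.
sum-gap : ∀ {n s} (f : Fin (suc n) → Fin s) → Increasing f →
          toℕ (f zero) ℕ.+ sum (gap f) ℕ.≤ s
sum-gap {zero} {s} f inc = subst (ℕ._≤ s) (sym (ℕ.+-identityʳ _)) (ℕ.<⇒≤ (Fin.toℕ<n (f zero)))
sum-gap {suc n} {s} f inc = subst (ℕ._≤ s)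
  (trans (cong (ℕ._+ sum (gap (f ∘ suc))) (sym (ℕ.m+[n∸m]≡n (ℕ.<⇒≤ (inc zero)))))
    (ℕ.+-assoc (toℕ (f zero)) (gap f zero) _))
  (sum-gap (f ∘ suc) (inc ∘ suc))

gap-injective : ∀ {n s} (f g : Fin (suc n) → Fin s) → Increasing f → Increasing g → ∀ {i j} →
                f (inject₁ i) ≡ g (inject₁ j) → gap f i ≡ gap g j → f (suc i) ≡ g (suc j)
gap-injective f g f↑ g↑ {i} {j} eq gap≡ = Fin.toℕ-injective
  (trans (sym (ℕ.m+[n∸m]≡n (ℕ.<⇒≤ (f↑ i))))
    (trans (cong₂ ℕ._+_ (cong toℕ eq) gap≡) (ℕ.m+[n∸m]≡n (ℕ.<⇒≤ (g↑ j)))))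

-- Scaled so that a weight of at most 4 s s′ bounds the gaps at i by 4 s / n and 4 s′ / n.
weight : ∀ {n s s′} → (Fin (suc n) → Fin s) → (Fin (suc n) → Fin s′) → Fin n → ℕ
weight {n} {s} {s′} f f′ i = n ℕ.* (gap f i ℕ.* s′ ℕ.+ gap f′ i ℕ.* s)

sum-weight : ∀ {n s s′} (f : Fin (suc n) → Fin s) (f′ : Fin (suc n) → Fin s′) →
             Increasing f → Increasing f′ →
             sum (weight f f′) ℕ.≤ n ℕ.* (s ℕ.* s′ ℕ.+ s′ ℕ.* s)
sum-weight {n} {s} {s′} f f′ f↑ f′↑ = begin
  sum (weight f f′)
    ≡⟨ sym (*-distribˡ-sum n (λ i → gap f i ℕ.* s′ ℕ.+ gap f′ i ℕ.* s)) ⟩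
  n ℕ.* sum (λ i → gap f i ℕ.* s′ ℕ.+ gap f′ i ℕ.* s)
    ≡⟨ cong (n ℕ.*_) (trans (∑-distrib-+ (λ i → gap f i ℕ.* s′) (λ i → gap f′ i ℕ.* s))
         (sym (cong₂ ℕ._+_ (*-distribʳ-sum s′ (gap f)) (*-distribʳ-sum s (gap f′))))) ⟩
  n ℕ.* (sum (gap f) ℕ.* s′ ℕ.+ sum (gap f′) ℕ.* s)
    ≤⟨ ℕ.*-monoʳ-≤ n (ℕ.+-mono-≤ (ℕ.*-monoˡ-≤ s′ (bound f f↑)) (ℕ.*-monoˡ-≤ s (bound f′ f′↑))) ⟩
  n ℕ.* (s ℕ.* s′ ℕ.+ s′ ℕ.* s) ∎
  where
  open ℕ.≤-Reasoning
  bound : ∀ {s} (f : Fin (suc n) → Fin s) → Increasing f → sum (gap f) ℕ.≤ s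
  bound f f↑ = ℕ.≤-trans (ℕ.m≤n+m _ (toℕ (f zero))) (sum-gap f f↑)

≤⌈/2⌉*2 : ∀ n → n ℕ.≤ 2 ℕ.* ℕ.⌈ n /2⌉
≤⌈/2⌉*2 n = begin
  n                            ≡⟨ sym (ℕ.⌊n/2⌋+⌈n/2⌉≡n n) ⟩
  ℕ.⌊ n /2⌋ ℕ.+ ℕ.⌈ n /2⌉      ≤⟨ ℕ.+-mono-≤ (ℕ.⌊n/2⌋≤⌈n/2⌉ n) (ℕ.m≤m+n _ 0) ⟩
  2 ℕ.* ℕ.⌈ n /2⌉              ∎
  where open ℕ.≤-Reasoning

-- The weights sum to at most 2n s s′, so the threshold 4 s s′ leaves at least half of the indices
-- light: n ≤ 2p. A light weight bounds each of its two summands, hence both gaps at once.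
short-gaps : ∀ {n s s′} .⦃ _ : NonZero n ⦄ (f : Fin (suc n) → Fin s) (f′ : Fin (suc n) → Fin s′) →
             Increasing f → Increasing f′ →
             ∃ λ (sel : Fin ℕ.⌈ n /2⌉ → Fin n) → Injective _≡_ _≡_ sel ×
               (∀ j → gap f (sel j) ℕ.≤ 4 ℕ.* s ℕ./ n × gap f′ (sel j) ℕ.≤ 4 ℕ.* s′ ℕ./ n)
short-gaps {n} {s} {s′} f f′ f↑ f′↑ with markov (weight f f′) (4 ℕ.* (s ℕ.* s′))
... | p , sel , inj , light , n*T≤ =
  sel ∘ half , (λ eq → Fin.inject≤-injective _ _ _ _ (inj eq)) , λ j →
    gap≤ (gap f (sel (half j))) s s′ (ℕ.≤-trans (ℕ.*-monoʳ-≤ n (ℕ.m≤m+n _ _)) (light (half j))) ,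
    gap≤ (gap f′ (sel (half j))) s′ s (ℕ.≤-trans (ℕ.*-monoʳ-≤ n (ℕ.m≤n+m _ (gap f (sel (half j)) ℕ.* s′)))
      (subst (n ℕ.* (gap f (sel (half j)) ℕ.* s′ ℕ.+ gap f′ (sel (half j)) ℕ.* s) ℕ.≤_)
        (cong (4 ℕ.*_) (ℕ.*-comm s s′)) (light (half j))))
  where
  open N
  -- The position of the first element inhabits `Fin s`, so `s` and likewise `s′` may be cancelled.
  instance
    _ : NonZero s
    _ = Fin.nonZeroIndex (f zero)
    _ : NonZero s′
    _ = Fin.nonZeroIndex (f′ zero)
  gap≤ : ∀ g s s′ .⦃ _ : NonZero s′ ⦄ → n ℕ.* (g ℕ.* s′) ℕ.≤ 4 ℕ.* (s ℕ.* s′) → g ℕ.≤ 4 ℕ.* s ℕ./ n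
  gap≤ g s s′ le = subst (ℕ._≤ 4 ℕ.* s ℕ./ n) (ℕ.m*n/n≡m g n)
    (ℕ./-monoˡ-≤ n (ℕ.*-cancelʳ-≤ (g ℕ.* n) (4 ℕ.* s) s′ (subst₂ ℕ._≤_
      (solve 3 (λ n g t → n :* (g :* t) := g :* n :* t) refl n g s′)
      (sym (ℕ.*-assoc 4 s s′)) le)))
  n≤p+p : n ℕ.≤ p ℕ.+ p
  n≤p+p = ℕ.*-cancelʳ-≤ n (p ℕ.+ p) (2 ℕ.* (s ℕ.* s′)) ⦃ ℕ.m*n≢0 2 (s ℕ.* s′) ⦃ _ ⦄ ⦃ ℕ.m*n≢0 s s′ ⦄ ⦄
    (ℕ.+-cancelʳ-≤ (n ℕ.* (2 ℕ.* (s ℕ.* s′))) _ _ (subst₂ ℕ._≤_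
      (solve 3 (λ n s t → n :* (con 4 :* (s :* t)) :=
        n :* (con 2 :* (s :* t)) :+ n :* (con 2 :* (s :* t))) refl n s s′)
      (solve 4 (λ n p s t → p :* (con 4 :* (s :* t)) :+ n :* (s :* t :+ t :* s) :=
        (p :+ p) :* (con 2 :* (s :* t)) :+ n :* (con 2 :* (s :* t))) refl n p s s′)
      (ℕ.≤-trans n*T≤ (ℕ.+-monoʳ-≤ (p ℕ.* (4 ℕ.* (s ℕ.* s′))) (sum-weight f f′ f↑ f′↑)))))
  -- The number `p` of light indices varies with `f` and `f′`. Restricting to exactly `⌈ n /2⌉` of
  -- them makes the count the same for all pairs of translates, as the encoding below requires.
  half : Fin ℕ.⌈ n /2⌉ → Fin p
  half j = Fin.inject≤ j (subst (ℕ.⌈ n /2⌉ ℕ.≤_) (sym (ℕ.n≡⌈n+n/2⌉ p)) (ℕ.⌈n/2⌉-mono n≤p+p))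

-- Injective encoding of pairs at short distance

SeparatesPairs : ∀ {n m m′ s s′} → (Fin m → Fin (suc n) → Fin s) →
                 (Fin m′ → Fin (suc n) → Fin s′) → Set
SeparatesPairs P P′ = ∀ b d b′ d′ i j →
  P b (inject₁ i) ≡ P d (inject₁ j) → P b (suc i) ≡ P d (suc j) →
  P′ b′ (inject₁ i) ≡ P′ d′ (inject₁ j) → P′ b′ (suc i) ≡ P′ d′ (suc j) →
  b ≡ d × b′ ≡ d′ × i ≡ j

remQuot-injective : ∀ {m} n {x y : Fin (m ℕ.* n)} → Fin.remQuot {m} n x ≡ Fin.remQuot n y → x ≡ y
remQuot-injective {m} n {x} {y} eq =
  trans (sym (Fin.combine-remQuot {m} n x)) (trans (cong (uncurry Fin.combine) eq) (Fin.combine-remQuot {m} n y))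

-- Gaps of an increasing map are positive, so a gap of at most `G` takes `G` values rather than
-- `G + 1`. The saved unit matters: `G` will be a quotient 4s / n that may be small, even 0.
pred-gap : ∀ {n s G} (f : Fin (suc n) → Fin s) → Increasing f → ∀ i → gap f i ℕ.≤ G → Fin G
pred-gap f f↑ i le = fromℕ< {ℕ.pred (gap f i)}
  (ℕ.<-≤-trans (ℕ.≤-reflexive (ℕ.suc-pred (gap f i) ⦃ ℕ.>-nonZero (ℕ.m<n⇒0<n∸m (f↑ i)) ⦄)) le)

pred-gap-injective : ∀ {n s G} (f g : Fin (suc n) → Fin s) (f↑ : Increasing f) (g↑ : Increasing g) {i j}
                     (le : gap f i ℕ.≤ G) (le′ : gap g j ℕ.≤ G) →
                     pred-gap f f↑ i le ≡ pred-gap g g↑ j le′ → gap f i ≡ gap g j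
pred-gap-injective f g f↑ g↑ {i} {j} _ _ eq = ℕ.pred-injective
  ⦃ ℕ.>-nonZero (ℕ.m<n⇒0<n∸m (f↑ i)) ⦄ ⦃ ℕ.>-nonZero (ℕ.m<n⇒0<n∸m (g↑ j)) ⦄
  (trans (sym (Fin.toℕ-fromℕ< _)) (trans (cong toℕ eq) (Fin.toℕ-fromℕ< _)))

-- A triple of two translates and a selected index is coded by the starting position and the gap in
-- each sumset. A code recovers both endpoints in both sumsets, and `sep` then recovers the triple,
-- so m m′ p ≤ (s G)(s′ G′).
module Encoding {n m m′ s s′ p G G′}
                (P : Fin m → Fin (suc n) → Fin s) (P′ : Fin m′ → Fin (suc n) → Fin s′)
                (P↑ : ∀ b → Increasing (P b)) (P′↑ : ∀ b → Increasing (P′ b))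
                (sep : SeparatesPairs P P′)
                (short : ∀ b b′ → ∃ λ (sel : Fin p → Fin n) → Injective _≡_ _≡_ sel ×
                  (∀ j → gap (P b) (sel j) ℕ.≤ G × gap (P′ b′) (sel j) ℕ.≤ G′)) where

  sel : Fin m → Fin m′ → Fin p → Fin n
  sel b b′ = proj₁ (short b b′)

  sel-short : ∀ b b′ j → gap (P b) (sel b b′ j) ℕ.≤ G × gap (P′ b′) (sel b b′ j) ℕ.≤ G′
  sel-short b b′ = proj₂ (proj₂ (short b b′))

  code : Fin m → Fin m′ → Fin p → Fin ((s ℕ.* G) ℕ.* (s′ ℕ.* G′))
  code b b′ j = let i = sel b b′ j ; le , le′ = sel-short b b′ j in
    Fin.combine
      (Fin.combine (P b (inject₁ i)) (pred-gap (P b) (P↑ b) i le))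
      (Fin.combine (P′ b′ (inject₁ i)) (pred-gap (P′ b′) (P′↑ b′) i le′))

  code-injective : ∀ {b b′ j d d′ k} → code b b′ j ≡ code d d′ k → b ≡ d × b′ ≡ d′ × j ≡ k
  code-injective {b} {b′} {j} {d} {d′} {k} eq
    with eq₁ , eq₂ ← Fin.combine-injective _ _ _ _ eq
    with P≡ , g≡ ← Fin.combine-injective {s} {G} _ _ _ _ eq₁
       | P′≡ , g′≡ ← Fin.combine-injective {s′} {G′} _ _ _ _ eq₂
    with refl , refl , i≡ ← sep b d b′ d′ (sel b b′ j) (sel d d′ k)
         P≡  (gap-injective (P b) (P d) (P↑ b) (P↑ d) P≡
               (pred-gap-injective (P b) (P d) (P↑ b) (P↑ d)
                 (proj₁ (sel-short b b′ j)) (proj₁ (sel-short d d′ k)) g≡))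
         P′≡ (gap-injective (P′ b′) (P′ d′) (P′↑ b′) (P′↑ d′) P′≡
               (pred-gap-injective (P′ b′) (P′ d′) (P′↑ b′) (P′↑ d′)
                 (proj₂ (sel-short b b′ j)) (proj₂ (sel-short d d′ k)) g′≡))
    -- With both translates identified, the two selections are the same function, and its
    -- injectivity gives `j ≡ k`.
    = refl , refl , proj₁ (proj₂ (short b b′)) i≡

  encode : Fin (m ℕ.* (m′ ℕ.* p)) → Fin ((s ℕ.* G) ℕ.* (s′ ℕ.* G′))
  encode x = let b , y = Fin.remQuot {m} (m′ ℕ.* p) x ; b′ , j = Fin.remQuot {m′} p y in code b b′ j

  encode-injective : Injective _≡_ _≡_ encode
  encode-injective eq with b≡ , b′≡ , j≡ ← code-injective eq =
    remQuot-injective {m} (m′ ℕ.* p) (cong₂ _,_ b≡ (remQuot-injective {m′} p (cong₂ _,_ b′≡ j≡)))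

-- Multiplying the encoding bound by 2n² undoes the halving n ≤ 2p and both floor divisions, since G
-- n ≤ 4s and G′ n ≤ 4s′; hence 32 = 2 · 4 · 4.
count-pairs : ∀ {n m m′ s s′} .⦃ _ : NonZero n ⦄
              (P : Fin m → Fin (suc n) → Fin s) (P′ : Fin m′ → Fin (suc n) → Fin s′) →
              (∀ b → Increasing (P b)) → (∀ b → Increasing (P′ b)) → SeparatesPairs P P′ →
              m ℕ.* m′ ℕ.* (n ℕ.* n ℕ.* n) ℕ.≤ 32 ℕ.* ((s ℕ.* s′) ℕ.* (s ℕ.* s′))
count-pairs {n} {m} {m′} {s} {s′} P P′ P↑ P′↑ sep = begin
  m ℕ.* m′ ℕ.* (n ℕ.* n ℕ.* n)
    ≤⟨ ℕ.*-monoʳ-≤ (m ℕ.* m′) (ℕ.*-monoʳ-≤ (n ℕ.* n) (≤⌈/2⌉*2 n)) ⟩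
  m ℕ.* m′ ℕ.* (n ℕ.* n ℕ.* (2 ℕ.* p))
    ≡⟨ solve 4 (λ a b n p → a :* b :* (n :* n :* (con 2 :* p)) :=
         con 2 :* n :* n :* (a :* (b :* p))) refl m m′ n p ⟩
  2 ℕ.* n ℕ.* n ℕ.* (m ℕ.* (m′ ℕ.* p))
    ≤⟨ ℕ.*-monoʳ-≤ (2 ℕ.* n ℕ.* n) (Fin.injective⇒≤ (Encoding.encode-injective P P′ P↑ P′↑ sep
         λ b b′ → short-gaps (P b) (P′ b′) (P↑ b) (P′↑ b′))) ⟩
  2 ℕ.* n ℕ.* n ℕ.* ((s ℕ.* G) ℕ.* (s′ ℕ.* G′))
    ≡⟨ solve 5 (λ n s G t H → con 2 :* n :* n :* ((s :* G) :* (t :* H)) :=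
         con 2 :* (s :* t) :* ((G :* n) :* (H :* n))) refl n s G s′ G′ ⟩
  2 ℕ.* (s ℕ.* s′) ℕ.* ((G ℕ.* n) ℕ.* (G′ ℕ.* n))
    ≤⟨ ℕ.*-monoʳ-≤ (2 ℕ.* (s ℕ.* s′)) (ℕ.*-mono-≤ (ℕ.m/n*n≤m (4 ℕ.* s) n) (ℕ.m/n*n≤m (4 ℕ.* s′) n)) ⟩
  2 ℕ.* (s ℕ.* s′) ℕ.* ((4 ℕ.* s) ℕ.* (4 ℕ.* s′))
    ≡⟨ solve 2 (λ s t → con 2 :* (s :* t) :* ((con 4 :* s) :* (con 4 :* t)) :=
         con 32 :* ((s :* t) :* (s :* t))) refl s s′ ⟩
  32 ℕ.* ((s ℕ.* s′) ℕ.* (s ℕ.* s′)) ∎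
  where
  open ℕ.≤-Reasoning
  open N
  p = ℕ.⌈ n /2⌉
  G = 4 ℕ.* s ℕ./ n
  G′ = 4 ℕ.* s′ ℕ./ n

-- Positions of translates in a sumset

inject₁<suc : ∀ {n} (i : Fin n) → inject₁ i Fin.< suc i
inject₁<suc i = Fin.≤̄⇒inject₁< {i = i} {j = i} ℕ.≤-refl

-- Double negation commutes with finite products, so excluded middle may be assumed for all
-- comparisons simultaneously.
¬¬-<-dec : ∀ {s} (f : Fin s → ℝ) → ¬ ¬ (∀ i j → Dec (f i < f j))
¬¬-<-dec f = sequence λ i → sequence λ j → ¬¬-excluded-middle
  where sequence = Fin.sequence (RawMonad.rawApplicative ¬¬-Monad)

module Sumset {k m s} (a : Fin k → ℝ) {B} (|B| : HasCardinality B m)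
              (|A+B| : HasCardinality (range a ⊕ B) s) where

  b : Fin m → ℝ
  b = proj₁ |B|

  sums : Fin s → ℝ
  sums = proj₁ |A+B|

  sum-index : ∀ j i → range sums (a i + b j)
  sum-index j i = proj₁ (proj₂ (proj₂ |A+B|))
    (a i , b j , (i , ≈.refl) , proj₂ (proj₂ (proj₂ |B|)) (j , ≈.refl) , ≈.refl)

  index : Fin m → Fin k → Fin s
  index j i = proj₁ (sum-index j i)

  index≈ : ∀ j i → a i + b j ≈ sums (index j i)
  index≈ j i = proj₂ (sum-index j i)

  translate-injective : ∀ {i j l} → a i + b j ≈ a i + b l → j ≡ l
  translate-injective {i} eq = proj₁ (proj₂ |B|) (+-cancelˡ (a i) eq)

  -- For fixed `i` the sums `a i + b j` are distinct. This bound settles `k = 1`, where there are no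
  -- gaps to count.
  m≤s : Fin k → m ℕ.≤ s
  m≤s i = Fin.injective⇒≤ {f = λ j → index j i} λ {j} {l} eq → translate-injective {i}
    (≈.trans (index≈ j i) (≈.trans (≈.reflexive (cong sums eq)) (≈.sym (index≈ l i))))

  module Position (_<?_ : ∀ i j → Dec (sums i < sums j)) where
    open Rank (λ i j → sums i < sums j) _<?_ <-irrefl <-trans

    position : Fin m → Fin k → Fin s
    position j i = rank (index j i)

    position-mono : ∀ j i i′ → a i < a i′ → position j i Fin.< position j i′
    position-mono j i i′ lt =
      rank-mono (<-resp-≈ (index≈ j i) (index≈ j i′) (+-monoˡ-< (b j) lt))

    position≡⇒≈ : ∀ j i j′ i′ → position j i ≡ position j′ i′ → a i + b j ≈ a i′ + b j′
    position≡⇒≈ j i j′ i′ eq = ≈.trans (index≈ j i) (≈.trans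
      (≮∧≯⇒≈ (rank≡⇒⊀ eq) (rank≡⇒⊀ (sym eq))) (≈.sym (index≈ j′ i′)))

-- Assembling the inequality

cube-suc-bound : ∀ n m m′ t .⦃ _ : NonZero n ⦄ → m ℕ.* m′ ℕ.* (n ℕ.* n ℕ.* n) ℕ.≤ 32 ℕ.* t →
                 suc n ^ 3 ℕ.* m ℕ.* m′ ℕ.≤ 256 ℕ.* t
cube-suc-bound n m m′ t le = begin
  suc n ^ 3 ℕ.* m ℕ.* m′
    -- As n ≥ 1, k = n + 1 is at most 2n. Cubing costs a factor 8, and 8 · 32 = 256.
    ≤⟨ ℕ.*-monoˡ-≤ m′ (ℕ.*-monoˡ-≤ m (ℕ.^-monoˡ-≤ 3 (ℕ.+-monoˡ-≤ n (ℕ.>-nonZero⁻¹ n)))) ⟩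
  (n ℕ.+ n) ^ 3 ℕ.* m ℕ.* m′
    ≡⟨ solve 3 (λ n m m′ → (n :+ n) :^ 3 :* m :* m′ := con 8 :* (m :* m′ :* (n :* n :* n)))
         refl n m m′ ⟩
  8 ℕ.* (m ℕ.* m′ ℕ.* (n ℕ.* n ℕ.* n))
    ≤⟨ ℕ.*-monoʳ-≤ 8 le ⟩
  8 ℕ.* (32 ℕ.* t)
    ≡⟨ sym (ℕ.*-assoc 8 32 t) ⟩
  256 ℕ.* t ∎
  where
  open ℕ.≤-Reasoning
  open N

one-bound : ∀ m m′ t → m ℕ.* m′ ℕ.≤ t → 1 ^ 3 ℕ.* m ℕ.* m′ ℕ.≤ 256 ℕ.* (t ℕ.* t)
one-bound m m′ t le = begin
  1 ^ 3 ℕ.* m ℕ.* m′      ≡⟨ cong (ℕ._* m′) (ℕ.*-identityˡ m) ⟩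
  m ℕ.* m′                ≤⟨ le ⟩
  t                       ≤⟨ n≤n*n t ⟩
  t ℕ.* t                 ≤⟨ ℕ.m≤n*m (t ℕ.* t) 256 ⟩
  256 ℕ.* (t ℕ.* t)       ∎
  where
  open ℕ.≤-Reasoning
  n≤n*n : ∀ n → n ℕ.≤ n ℕ.* n
  n≤n*n zero    = ℕ.z≤n
  n≤n*n (suc n) = ℕ.m≤n*m (suc n) (suc n)

square-bound : ∀ {k m m′ s s′} (a a′ : Fin k → ℝ) →
  StrictlyIncreasing a → StrictlyIncreasing a′ → DistinctDifferencePairs a a′ →
  ∀ {B B′ : Pred ℝ 0ℓ} → HasCardinality B m → HasCardinality B′ m′ →
  HasCardinality (range a ⊕ B) s → HasCardinality (range a′ ⊕ B′) s′ →
  ¬ ¬ k ^ 3 ℕ.* m ℕ.* m′ ℕ.≤ 256 ℕ.* ((s ℕ.* s′) ℕ.* (s ℕ.* s′))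
square-bound {zero} _ _ _ _ _ _ _ _ _ ¬le = ¬le ℕ.z≤n
square-bound {suc zero} {m} {m′} {s} {s′} a a′ _ _ _ |B| |B′| |A+B| |A′+B′| ¬le = ¬le (one-bound m m′ (s ℕ.* s′)
  (ℕ.*-mono-≤ (Sumset.m≤s a |B| |A+B| zero) (Sumset.m≤s a′ |B′| |A′+B′| zero)))
square-bound {suc n@(suc _)} {m} {m′} {s} {s′} a a′ a↑ a′↑ distinct |B| |B′| |A+B| |A′+B′| ¬le =
  -- The goal here is absurdity, so the order on both sumsets may be taken as decided.
  ¬¬-<-dec S.sums λ _<?_ → ¬¬-<-dec S′.sums λ _<′?_ →
    let module P  = S.Position _<?_
        module P′ = S′.Position _<′?_
    in ¬le (cube-suc-bound n m m′ ((s ℕ.* s′) ℕ.* (s ℕ.* s′))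
      (count-pairs {n} {m} {m′} {s} {s′} P.position P′.position
         (λ j i → P.position-mono j (inject₁ i) (suc i) (a↑ (inject₁ i) (suc i) (inject₁<suc i)))
         (λ j i → P′.position-mono j (inject₁ i) (suc i) (a′↑ (inject₁ i) (suc i) (inject₁<suc i)))
         λ b d b′ d′ i j p≡ q≡ p′≡ q′≡ → separates b d b′ d′ i j
           (P.position≡⇒≈ b (inject₁ i) d (inject₁ j) p≡)
           (P.position≡⇒≈ b (suc i) d (suc j) q≡)
           (P′.position≡⇒≈ b′ (inject₁ i) d′ (inject₁ j) p′≡)
           (P′.position≡⇒≈ b′ (suc i) d′ (suc j) q′≡)))
  where
  module S  = Sumset a |B| |A+B|
  module S′ = Sumset a′ |B′| |A′+B′|
  separates : ∀ b d b′ d′ i j →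
    a (inject₁ i) + S.b b ≈ a (inject₁ j) + S.b d → a (suc i) + S.b b ≈ a (suc j) + S.b d →
    a′ (inject₁ i) + S′.b b′ ≈ a′ (inject₁ j) + S′.b d′ → a′ (suc i) + S′.b b′ ≈ a′ (suc j) + S′.b d′ →
    b ≡ d × b′ ≡ d′ × i ≡ j
  separates b d b′ d′ i j p q p′ q′ =
    S.translate-injective {inject₁ i}
      (subst (λ l → a (inject₁ i) + S.b b ≈ a (inject₁ l) + S.b d) (sym i≡j) p) ,
    S′.translate-injective {inject₁ i}
      (subst (λ l → a′ (inject₁ i) + S′.b b′ ≈ a′ (inject₁ l) + S′.b d′) (sym i≡j) p′) ,
    i≡j
    where
    -- Subtracting the two equalities in each sumset cancels the translates and equates the
    -- difference pairs. This comes first because cancelling `a (inject₁ i)` to compare translates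
    -- presupposes equal indices.
    i≡j : i ≡ j
    i≡j = decidable-stable (i Fin.≟ j) λ i≢j → distinct i j i≢j
      (translates-difference p q , translates-difference p′ q′)

theorem3 : ∃[ c ] 0ℝ < c ×
    (∀ (k : ℕ) (a a′ : Fin k → ℝ) →
    StrictlyIncreasing a → StrictlyIncreasing a′ →
    DistinctDifferencePairs a a′ →
    ∀ (B B′ : Pred ℝ 0ℓ) (m m′ : ℕ) →
    HasCardinality B m → HasCardinality B′ m′ →
    Satisfiable B → Satisfiable B′ →
    ∀ (s s′ : ℕ) →
    HasCardinality (range a ⊕ B) s → HasCardinality (range a′ ⊕ B′) s′ →
    c * √ (k ^ 3 ℕ.* m ℕ.* m′) ≤ fromℕ (s ℕ.* s′) ×
    (m ≡ k → m′ ≡ k → c * √ (k ^ 5) ≤ fromℕ (s ℕ.* s′)))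
-- The constant is 1 / √256.
theorem3 = fromℚ (+ 1 ℚ./ 16) , mk< (+ 1 ℚ./ 16 , ℚ.positive⁻¹ (+ 1 ℚ./ 16) , 0 , λ _ _ → ℚ.≤-refl) ,
  λ k a a′ a↑ a′↑ distinct B B′ m m′ |B| |B′| _ _ s s′ |A+B| |A′+B′| →
    -- The inequality of naturals is decidable, which discharges the double negation.
    let bound = sixteenth-√≤ {k ^ 3 ℕ.* m ℕ.* m′} {s ℕ.* s′} (decidable-stable
                  (k ^ 3 ℕ.* m ℕ.* m′ ℕ.≤? 256 ℕ.* ((s ℕ.* s′) ℕ.* (s ℕ.* s′)))
                  (square-bound a a′ a↑ a′↑ distinct |B| |B′| |A+B| |A′+B′|))
    in bound , λ { refl refl → subst (λ n → fromℚ (+ 1 ℚ./ 16) * √ n ≤ fromℕ (s ℕ.* s′)) (k³kk≡k⁵ k) bound }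
  where
  open N
  k³kk≡k⁵ : ∀ k → k ^ 3 ℕ.* k ℕ.* k ≡ k ^ 5
  k³kk≡k⁵ = solve 1 (λ k → k :^ 3 :* k :* k := k :^ 5) refl
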